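{- Let $r\geq 1$ and $n\geq 4r^2$ be integers. If $\mathcal{A},\mathcal{B}\subseteq\binom{[n]}{r}$ are cross-intersecting, then $\sigma_r(\mathcal{A})\,\sigma_r(\mathcal{B})\leq r^2\binom{n-2}{r-2}^2$.
   Context: For an $r$-uniform hypergraph $\mathcal{H}\subseteq\binom{[n]}{r}$ (a family of $r$-subsets of $[n]=\{1,\dots,n\}$), $\deg(v)$ is the number of edges containing $v$, $\deg(S)=\sum_{v\in S}\deg(v)$ for an $r$-set $S$, and the Ore-degree $\sigma_r(\mathcal{H})$ is the minimum of $\deg(S)$ over all $r$-subsets $S\subseteq[n]$ with $S\notin\mathcal{H}$. Two families $\mathcal{A},\mathcal{B}$ are cross-intersecting if $A\cap B\neq\emptyset$ for all $A\in\mathcal{A}$, $B\in\mathcal{B}$. -}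

module Defs where

open import Data.Bool using (Bool; true; false; if_then_else_; _∧_; not)
open import Data.Nat using (ℕ; zero; suc; _+_; _*_; _∸_; _⊓_; _≡ᵇ_)
open import Data.Nat.Combinatorics using (_C_)
open import Data.Fin using (Fin)
open import Data.Fin.Subset using (Subset; ∣_∣; _∩_; Nonempty)
open import Data.Vec using (_∷_; []; lookup)
open import Data.List using (List; []; _∷_; map; _++_; filter; foldr; allFin)
open import Data.Nat.ListAction using (sum)
open import Relation.Binary.PropositionalEquality using (_≡_)
open import Relation.Nullary.Decidable using (yes; no)
open import Data.Bool using (T?)

Family : ℕ → Set
Family n = Subset n → Bool

Uniform : ∀ {n} → ℕ → Family n → Set
Uniform r H = ∀ S → H S ≡ true → ∣ S ∣ ≡ r

allSubsets : (n : ℕ) → List (Subset n)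
allSubsets zero = [] ∷ []
allSubsets (suc n) = map (true ∷_) (allSubsets n) ++ map (false ∷_) (allSubsets n)

rSubsets : (n r : ℕ) → List (Subset n)
rSubsets n r = filter (λ S → T? (∣ S ∣ ≡ᵇ r)) (allSubsets n)

b2n : Bool → ℕ
b2n true = 1
b2n false = 0

deg : ∀ {n} → ℕ → Family n → Fin n → ℕ
deg {n} r H v = sum (map (λ E → b2n (H E ∧ lookup E v)) (rSubsets n r))

degSet : ∀ {n} → ℕ → Family n → Subset n → ℕ
degSet {n} r H S = sum (map (λ v → if lookup S v then deg r H v else 0) (allFin n))

-- minimum of a list of naturals; the empty list gets the (immaterial) value 0
minList : List ℕ → ℕ
minList [] = 0
minList (x ∷ xs) = foldr _⊓_ x xs

σ : ∀ {n} → ℕ → Family n → ℕ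
σ {n} r H = minList (map (degSet r H) (filter (λ S → T? (not (H S))) (rSubsets n r)))

CrossIntersecting : ∀ {n} → Family n → Family n → Set
CrossIntersecting A B = ∀ S T → A S ≡ true → B T ≡ true → Nonempty (S ∩ T)

-- binomial coefficient C(n-2, r-2), with C(m, k) = 0 for k < 0 (i.e. r < 2)
binom-2 : ℕ → ℕ → ℕ
binom-2 n zero = 0
binom-2 n (suc zero) = 0
binom-2 n (suc (suc k)) = (n ∸ 2) C k

{-# OPTIONS --safe #-}

-- Every edge F of B meets all edges of A, so all r-subsets of the complement of F are non-edges of A;
-- averaging over the complement gives (n − r) σ(A) ≤ r (r − 1) |A|, and likewise for B.
-- Let S and T be minimum transversals of A and B, with s = |S| and t = |T|. A set of fewer than t
-- vertices is missed by some edge of B, so branching over such edges gives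
-- deg_A(w) ≤ r^(t-1) C(n-t, r-t), and summing over w ∈ S, 4^(t-1) |A| ≤ s C(n-1, r-1) since n ≥ 4r².
-- With the symmetric bound, 2 |A| |B| ≤ C(n-1, r-1)² as soon as s or t exceeds 1, and this suffices.
-- If s = t = 1, either A and B share a transversal vertex v, and the r-subsets avoiding v give the
-- bound directly, or an edge of B misses S and already 4 |A| ≤ C(n-1, r-1).
module Submission where

open import Defs
import Algebra.Properties.CommutativeSemigroup
open import Data.Bool using (Bool; true; false; if_then_else_; _∧_; not; T; T?)
open import Data.Bool.Properties using (∧-zeroʳ; ∧-conicalˡ; ∧-conicalʳ; T-≡; ¬-not; _≟_)
open import Data.Fin using (Fin; zero; suc)
open import Data.Fin.Subset
open import Data.Fin.Subset.Properties
open import Data.List using (List; []; _∷_; map; _++_; filter; foldr; allFin)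
open import Data.List.Membership.Propositional using () renaming (_∈_ to _∈ˡ_)
open import Data.List.Membership.Propositional.Properties using (∈-filter⁺; ∈-map⁺; ∈-++⁺ˡ; ∈-++⁺ʳ)
open import Data.List.Properties using (map-tabulate; map-++; map-cong)
open import Data.List.Relation.Unary.Any using (here; there)
open import Data.Nat hiding (_≟_)
open import Data.Nat.Combinatorics using (_C_; nC1≡n; nCk+nC[k+1]≡[n+1]C[k+1])
open import Data.Nat.ListAction using (sum)
open import Data.Nat.ListAction.Properties using (sum-++)
open import Data.Nat.Properties hiding (_≟_)
open import Data.Nat.Tactic.RingSolver using (solve-∀)
open import Data.Product using (∃; _×_; _,_; proj₁; proj₂)
open import Data.Sum using (_⊎_; inj₁; inj₂)
open import Data.Vec using ([]; _∷_; lookup; _[_]≔_; here; there)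
open import Data.Vec.Properties using ([]=⇒lookup; lookup⇒[]=; lookup∘update′; lookup-replicate)
open import Function using (_∘_)
open import Function.Bundles using (Equivalence)
open import Relation.Binary.PropositionalEquality
open import Relation.Nullary using (Dec; yes; no; contradiction)
open import Relation.Nullary.Decidable using (_×-dec_; ¬?; decidable-stable)

open Algebra.Properties.CommutativeSemigroup +-commutativeSemigroup using ()
  renaming (interchange to +-interchange; x∙yz≈y∙xz to +-swap)
open Algebra.Properties.CommutativeSemigroup *-commutativeSemigroup using ()
  renaming (interchange to *-interchange; x∙yz≈y∙xz to *-swap)

private
  variable
    X Y : Set
    n : ℕ

-- Finite sums over lists

∑ : List X → (X → ℕ) → ℕ
∑ xs f = sum (map f xs)

∑-mono : ∀ (xs : List X) {f g} → (∀ x → f x ≤ g x) → ∑ xs f ≤ ∑ xs g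
∑-mono []       f≤g = z≤n
∑-mono (x ∷ xs) f≤g = +-mono-≤ (f≤g x) (∑-mono xs f≤g)

∑-zero : ∀ (xs : List X) {f} → (∀ x → f x ≡ 0) → ∑ xs f ≡ 0
∑-zero []       f≡0 = refl
∑-zero (x ∷ xs) f≡0 = cong₂ _+_ (f≡0 x) (∑-zero xs f≡0)

∑-+ : ∀ (xs : List X) f g → ∑ xs (λ x → f x + g x) ≡ ∑ xs f + ∑ xs g
∑-+ []       f g = refl
∑-+ (x ∷ xs) f g rewrite ∑-+ xs f g = +-interchange (f x) (g x) (∑ xs f) (∑ xs g)

∑-*ˡ : ∀ (xs : List X) c f → ∑ xs (λ x → c * f x) ≡ c * ∑ xs f
∑-*ˡ []       c f = sym (*-zeroʳ c)
∑-*ˡ (x ∷ xs) c f rewrite ∑-*ˡ xs c f = sym (*-distribˡ-+ c (f x) (∑ xs f))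

∑-++ : ∀ (xs ys : List X) f → ∑ (xs ++ ys) f ≡ ∑ xs f + ∑ ys f
∑-++ xs ys f = trans (cong sum (map-++ f xs ys)) (sum-++ (map f xs) (map f ys))

∑-map : ∀ (g : X → Y) xs f → ∑ (map g xs) f ≡ ∑ xs (f ∘ g)
∑-map g []       f = refl
∑-map g (x ∷ xs) f = cong (f (g x) +_) (∑-map g xs f)

∑-filter : ∀ (p q : X → Bool) xs →
  ∑ (filter (T? ∘ p) xs) (b2n ∘ q) ≡ ∑ xs (λ x → b2n (p x ∧ q x))
∑-filter p q [] = refl
∑-filter p q (x ∷ xs) with p x
... | true  = cong (b2n (q x) +_) (∑-filter p q xs)
... | false = ∑-filter p q xs

b2n-mono : ∀ {x y} → (x ≡ true → y ≡ true) → b2n x ≤ b2n y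
b2n-mono {false} _   = z≤n
b2n-mono {true}  x⇒y rewrite x⇒y refl = ≤-refl

-- Weights of vertex sets

-- `degSet r H` is `weight (deg r H)` by definition, so bounds for arbitrary vertex weights apply to
-- degree sums without conversion.
weight : (Fin n → ℕ) → Subset n → ℕ
weight d U = ∑ (allFin _) (λ v → if lookup U v then d v else 0)

weight-∷ : ∀ (d : Fin (suc n) → ℕ) b U →
  weight d (b ∷ U) ≡ (if b then d zero else 0) + weight (d ∘ suc) U
weight-∷ {n} d b U = cong (λ l → (if b then d zero else 0) + sum l)
  (trans (map-tabulate suc f) (sym (map-tabulate (λ i → i) (f ∘ suc))))
  where
  f : Fin (suc n) → ℕ
  f v = if lookup (b ∷ U) v then d v else 0

weight-≤ : ∀ {d} M (U : Subset n) → (∀ v → v ∈ U → d v ≤ M) → weight d U ≤ ∣ U ∣ * M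
weight-≤ M [] d≤M = z≤n
weight-≤ {d = d} M (true ∷ U) d≤M rewrite weight-∷ d true U =
  +-mono-≤ (d≤M zero here) (weight-≤ M U λ v v∈U → d≤M (suc v) (there v∈U))
weight-≤ {d = d} M (false ∷ U) d≤M rewrite weight-∷ d false U =
  weight-≤ M U λ v v∈U → d≤M (suc v) (there v∈U)

term≤weight : ∀ d {U : Subset n} {v} → v ∈ U → d v ≤ weight d U
term≤weight d {true ∷ U} here rewrite weight-∷ d true U = m≤m+n _ _
term≤weight d {b ∷ U} (there v∈U) rewrite weight-∷ d b U =
  ≤-trans (term≤weight (d ∘ suc) v∈U) (m≤n+m _ _)

-- Exchange of summation, the basis of every double count below.
weight-∑ : ∀ (xs : List X) (g : Fin n → X → ℕ) U →
  weight (λ v → ∑ xs (g v)) U ≡ ∑ xs (λ x → weight (λ v → g v x) U)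
weight-∑ xs g [] = sym (∑-zero xs λ _ → refl)
weight-∑ xs g (b ∷ U) = begin
  weight (λ v → ∑ xs (g v)) (b ∷ U)
    ≡⟨ weight-∷ _ b U ⟩
  (if b then ∑ xs (g zero) else 0) + weight (λ v → ∑ xs (g (suc v))) U
    ≡⟨ cong₂ _+_ (head b) (weight-∑ xs (g ∘ suc) U) ⟩
  ∑ xs (λ x → if b then g zero x else 0) + ∑ xs (λ x → weight (λ v → g (suc v) x) U)
    ≡⟨ ∑-+ xs _ _ ⟨
  ∑ xs (λ x → (if b then g zero x else 0) + weight (λ v → g (suc v) x) U)
    ≡⟨ cong sum (map-cong (λ x → weight-∷ (λ v → g v x) b U) xs) ⟨
  ∑ xs (λ x → weight (λ v → g v x) (b ∷ U)) ∎
  where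
  open ≡-Reasoning
  head : ∀ b → (if b then ∑ xs (g zero) else 0) ≡ ∑ xs (λ x → if b then g zero x else 0)
  head true  = refl
  head false = sym (∑-zero xs λ _ → refl)

weight-indicator : ∀ (U E : Subset n) → weight (b2n ∘ lookup E) U ≡ ∣ U ∩ E ∣
weight-indicator [] [] = refl
weight-indicator (true ∷ U) (true ∷ E)
  rewrite weight-∷ (b2n ∘ lookup (true ∷ E)) true U = cong suc (weight-indicator U E)
weight-indicator (true ∷ U) (false ∷ E)
  rewrite weight-∷ (b2n ∘ lookup (false ∷ E)) true U = weight-indicator U E
weight-indicator (false ∷ U) (b ∷ E)
  rewrite weight-∷ (b2n ∘ lookup (b ∷ E)) false U = weight-indicator U E

-- Inserting and deleting a vertex; light subsets

∣insert∣ : ∀ {U : Subset n} {v} → v ∉ U → ∣ U [ v ]≔ true ∣ ≡ suc ∣ U ∣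
∣insert∣ {U = true ∷ U}  {zero}  v∉U = contradiction here v∉U
∣insert∣ {U = false ∷ U} {zero}  v∉U = refl
∣insert∣ {U = true ∷ U}  {suc v} v∉U = cong suc (∣insert∣ (v∉U ∘ there))
∣insert∣ {U = false ∷ U} {suc v} v∉U = ∣insert∣ (v∉U ∘ there)

∣remove∣ : ∀ {U : Subset n} {v} → v ∈ U → suc ∣ U [ v ]≔ false ∣ ≡ ∣ U ∣
∣remove∣ here = refl
∣remove∣ {U = true ∷ U}  (there v∈U) = cong suc (∣remove∣ v∈U)
∣remove∣ {U = false ∷ U} (there v∈U) = ∣remove∣ v∈U

remove-⊆ : ∀ (U : Subset n) v → U [ v ]≔ false ⊆ U
remove-⊆ (b ∷ U) zero    (there x∈U) = there x∈U
remove-⊆ (b ∷ U) (suc v) here        = here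
remove-⊆ (b ∷ U) (suc v) (there x∈U) = there (remove-⊆ U v x∈U)

weight-remove : ∀ d {U : Subset n} {v} → v ∈ U → weight d U ≡ d v + weight d (U [ v ]≔ false)
weight-remove d {true ∷ U} here =
  trans (weight-∷ d true U) (cong (d zero +_) (sym (weight-∷ d false U)))
weight-remove d {b ∷ U} {suc v} (there v∈U)
  rewrite weight-∷ d b U | weight-∷ d b (U [ v ]≔ false) | weight-remove (d ∘ suc) v∈U =
  +-swap (if b then d zero else 0) (d (suc v)) (weight (d ∘ suc) (U [ v ]≔ false))

heaviest : ∀ (d : Fin n → ℕ) U → Nonempty U → ∃ λ v → v ∈ U × (∀ u → u ∈ U → d u ≤ d v)
heaviest d (false ∷ U) (suc v , there v∈U) with heaviest (d ∘ suc) U (v , v∈U)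
... | w , w∈U , max = suc w , there w∈U , λ { (suc u) (there u∈U) → max u u∈U }
heaviest d (true ∷ U) _ with nonempty? U
... | no U≡∅ = zero , here , λ
  { zero    _           → ≤-refl
  ; (suc u) (there u∈U) → contradiction (u , u∈U) U≡∅ }
... | yes U≢∅ with heaviest (d ∘ suc) U U≢∅
... | w , w∈U , max with ≤-total (d zero) (d (suc w))
... | inj₁ 0≤w = suc w , there w∈U , λ { zero _ → 0≤w ; (suc u) (there u∈U) → max u u∈U }
... | inj₂ w≤0 = zero , here , λ
  { zero    _           → ≤-refl
  ; (suc u) (there u∈U) → ≤-trans (max u u∈U) w≤0 }

-- Discard a heaviest vertex of U until r vertices remain; the average weight never increases.
lightSubset : ∀ {r} → 1 ≤ r → (d : Fin n → ℕ) → ∀ m U → ∣ U ∣ ≡ m + r →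
  ∃ λ S → S ⊆ U × ∣ S ∣ ≡ r × ∣ U ∣ * weight d S ≤ r * weight d U
lightSubset 1≤r d zero U ∣U∣ = U , (λ x∈U → x∈U) , ∣U∣ , ≤-reflexive (cong (_* weight d U) ∣U∣)
lightSubset {n} {r} 1≤r d (suc m) U ∣U∣ with nonempty? U
... | no U≡∅ = contradiction
  (trans (sym ∣U∣) (trans (cong ∣_∣ (Empty-unique U≡∅)) (∣⊥∣≡0 n))) λ ()
... | yes U≢∅ with heaviest d U U≢∅
... | v , v∈U , max with lightSubset 1≤r d m (U [ v ]≔ false) (suc-injective (trans (∣remove∣ v∈U) ∣U∣))
... | S , S⊆ , ∣S∣ , avg =
  S , (λ x∈S → remove-⊆ U v (S⊆ x∈S)) , ∣S∣ , goal
  where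
  open ≤-Reasoning
  U' = U [ v ]≔ false
  k = ∣ U' ∣
  ∣U'∣ : k ≡ m + r
  ∣U'∣ = suc-injective (trans (∣remove∣ v∈U) ∣U∣)
  instance
    k≢0 : NonZero k
    k≢0 = >-nonZero (subst (0 <_) (sym ∣U'∣) (≤-trans 1≤r (m≤n+m r m)))
  -- Maximality of `v` gives `weight d U ≤ ∣ U ∣ * d v`, so deleting `v` cannot raise the average.
  shrink : suc k * weight d U' ≤ k * weight d U
  shrink = +-cancelˡ-≤ (suc k * d v) _ _ (begin
    suc k * d v + suc k * weight d U'  ≡⟨ *-distribˡ-+ (suc k) (d v) _ ⟨
    suc k * (d v + weight d U')        ≡⟨ cong (suc k *_) (weight-remove d v∈U) ⟨
    weight d U + k * weight d U
      ≤⟨ +-monoˡ-≤ _ (subst (λ c → weight d U ≤ c * d v) (sym (∣remove∣ v∈U)) (weight-≤ (d v) U max)) ⟩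
    suc k * d v + k * weight d U       ∎)
  goal : ∣ U ∣ * weight d S ≤ r * weight d U
  goal = *-cancelˡ-≤ k (begin
    k * (∣ U ∣ * weight d S)     ≡⟨ cong (λ c → k * (c * weight d S)) (∣remove∣ v∈U) ⟨
    k * (suc k * weight d S)     ≡⟨ *-swap k (suc k) _ ⟩
    suc k * (k * weight d S)     ≤⟨ *-monoʳ-≤ (suc k) avg ⟩
    suc k * (r * weight d U')    ≡⟨ *-swap (suc k) r _ ⟩
    r * (suc k * weight d U')    ≤⟨ *-monoʳ-≤ r shrink ⟩
    r * (k * weight d U)         ≡⟨ *-swap r k _ ⟩
    k * (r * weight d U)         ∎)

-- Ore-degree

minList-≤ : ∀ {x xs} → x ∈ˡ xs → minList xs ≤ x
minList-≤ {xs = y ∷ ys} (here refl) = base y ys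
  where
  base : ∀ y ys → foldr _⊓_ y ys ≤ y
  base y []       = ≤-refl
  base y (z ∷ ys) = ≤-trans (m⊓n≤n z _) (base y ys)
minList-≤ {xs = y ∷ ys} (there x∈ys) = tail x∈ys
  where
  tail : ∀ {x zs} → x ∈ˡ zs → foldr _⊓_ y zs ≤ x
  tail {zs = z ∷ zs} (here refl)  = m⊓n≤m z _
  tail {zs = z ∷ zs} (there x∈zs) = ≤-trans (m⊓n≤n z _) (tail x∈zs)

∈-allSubsets : (S : Subset n) → S ∈ˡ allSubsets n
∈-allSubsets []          = here refl
∈-allSubsets (true ∷ S)  = ∈-++⁺ˡ (∈-map⁺ _ (∈-allSubsets S))
∈-allSubsets (false ∷ S) = ∈-++⁺ʳ _ (∈-map⁺ _ (∈-allSubsets S))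

σ≤degSet : ∀ {r} (H : Family n) S → ∣ S ∣ ≡ r → H S ≡ false → σ r H ≤ degSet r H S
σ≤degSet {n} {r} H S ∣S∣ S∉H = minList-≤ (∈-map⁺ (degSet r H)
  (∈-filter⁺ (λ S → T? (not (H S)))
    (∈-filter⁺ (λ S → T? (∣ S ∣ ≡ᵇ r)) (∈-allSubsets S) (≡⇒≡ᵇ _ _ ∣S∣))
    (subst (T ∘ not) (sym S∉H) _)))

-- The light `r`-subset found by averaging lies in `U`, so it is a non-edge and takes part in the
-- minimum that defines `σ`.
σ≤average : ∀ {r} → 1 ≤ r → (H : Family n) → ∀ U → r ≤ ∣ U ∣ →
  (∀ S → S ⊆ U → ∣ S ∣ ≡ r → H S ≡ false) → ∣ U ∣ * σ r H ≤ r * degSet r H U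
σ≤average {r = r} 1≤r H U r≤U ∉H
  with lightSubset 1≤r (deg r H) (∣ U ∣ ∸ r) U (sym (m∸n+n≡m r≤U))
... | S , S⊆U , ∣S∣ , avg =
  ≤-trans (*-monoʳ-≤ ∣ U ∣ (σ≤degSet H S ∣S∣ (∉H S S⊆U ∣S∣))) avg

-- Codegrees

-- Boolean, and recursive in step with `allSubsets`, so that it can stand inside `b2n` indicators.
_⊆ᵇ_ : Subset n → Subset n → Bool
[]          ⊆ᵇ []      = true
(true ∷ U)  ⊆ᵇ (b ∷ E) = b ∧ (U ⊆ᵇ E)
(false ∷ U) ⊆ᵇ (_ ∷ E) = U ⊆ᵇ E

⊥-⊆ᵇ : (E : Subset n) → (⊥ ⊆ᵇ E) ≡ true
⊥-⊆ᵇ []      = refl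
⊥-⊆ᵇ (_ ∷ E) = ⊥-⊆ᵇ E

insert-⊆ᵇ : ∀ (U : Subset n) {E v} → (U ⊆ᵇ E) ≡ true → v ∈ E → ((U [ v ]≔ true) ⊆ᵇ E) ≡ true
insert-⊆ᵇ (true ∷ U)  U⊆E here = U⊆E
insert-⊆ᵇ (false ∷ U) U⊆E here = U⊆E
insert-⊆ᵇ (true ∷ U) {true ∷ E} U⊆E (there v∈E) = insert-⊆ᵇ U U⊆E v∈E
insert-⊆ᵇ (false ∷ U) U⊆E (there v∈E) = insert-⊆ᵇ U U⊆E v∈E

⊆ᵇ⇒∣∣≤ : ∀ (U E : Subset n) → (U ⊆ᵇ E) ≡ true → ∣ U ∣ ≤ ∣ E ∣
⊆ᵇ⇒∣∣≤ [] [] _ = z≤n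
⊆ᵇ⇒∣∣≤ (true ∷ U)  (true ∷ E)  U⊆E = s≤s (⊆ᵇ⇒∣∣≤ U E U⊆E)
⊆ᵇ⇒∣∣≤ (false ∷ U) (b ∷ E)     U⊆E = ≤-trans (⊆ᵇ⇒∣∣≤ U E U⊆E) (∣p∣≤∣x∷p∣ b E)

codeg : ℕ → Family n → Subset n → ℕ
codeg {n} r H U = ∑ (rSubsets n r) (λ E → b2n (H E ∧ (U ⊆ᵇ E)))

-- The size condition is an indicator over `allSubsets` instead of a filter, so that the sum splits
-- on the first coordinate.
#supersets : ℕ → Subset n → ℕ
#supersets {n} r U = ∑ (allSubsets n) (λ E → b2n ((∣ E ∣ ≡ᵇ r) ∧ (U ⊆ᵇ E)))

codeg≤#supersets : ∀ r (H : Family n) U → codeg r H U ≤ #supersets r U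
codeg≤#supersets {n} r H U =
  ≤-trans (∑-mono (rSubsets n r) λ E → b2n-mono (∧-conicalʳ (H E) (U ⊆ᵇ E)))
          (≤-reflexive (∑-filter (λ E → ∣ E ∣ ≡ᵇ r) (U ⊆ᵇ_) (allSubsets n)))

∑-allSubsets : ∀ (f : Subset (suc n) → ℕ) →
  ∑ (allSubsets (suc n)) f ≡ ∑ (allSubsets n) (f ∘ (true ∷_)) + ∑ (allSubsets n) (f ∘ (false ∷_))
∑-allSubsets {n} f = trans (∑-++ (map (true ∷_) (allSubsets n)) _ f)
  (cong₂ _+_ (∑-map (true ∷_) (allSubsets n) f) (∑-map (false ∷_) (allSubsets n) f))

#supersets-zero : ∀ {r} (U : Subset n) → r < ∣ U ∣ → #supersets r U ≡ 0
#supersets-zero {n} {r} U r<∣U∣ = ∑-zero (allSubsets n) λ E → n≤0⇒n≡0 (b2n-mono {y = false} λ e →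
  let ∣E∣ = ≡ᵇ⇒≡ ∣ E ∣ r (Equivalence.from T-≡ (∧-conicalˡ (∣ E ∣ ≡ᵇ r) (U ⊆ᵇ E) e))
      U⊆E = ∧-conicalʳ (∣ E ∣ ≡ᵇ r) (U ⊆ᵇ E) e
  in contradiction (≤-trans (⊆ᵇ⇒∣∣≤ U E U⊆E) (≤-reflexive ∣E∣)) (<⇒≱ r<∣U∣))

-- Induction on the ground set: a coordinate in `U` is forced, and one outside `U` gives Pascal's
-- rule. For `k = 0` the branch that adds an outside coordinate leaves too few vertices to contain
-- `U`.
#supersets≡ : ∀ {r} k (U : Subset n) → ∣ U ∣ + k ≡ r → #supersets r U ≡ ∣ ∁ U ∣ C k
#supersets≡ zero    [] refl = refl
#supersets≡ (suc k) [] refl = refl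
#supersets≡ {n = suc n} k (true ∷ U) refl = trans (∑-allSubsets (λ E → b2n ((∣ E ∣ ≡ᵇ _) ∧ ((true ∷ U) ⊆ᵇ E))))
  (trans (cong₂ _+_ (#supersets≡ k U refl)
           (∑-zero (allSubsets n) λ E → cong b2n (∧-zeroʳ (∣ E ∣ ≡ᵇ suc (∣ U ∣ + k)))))
         (+-identityʳ _))
#supersets≡ {n = suc n} {r = zero} zero (false ∷ U) eq = trans
  (∑-allSubsets (λ E → b2n ((∣ E ∣ ≡ᵇ 0) ∧ ((false ∷ U) ⊆ᵇ E))))
  (cong₂ _+_ (∑-zero (allSubsets n) λ _ → refl) (#supersets≡ zero U eq))
#supersets≡ {r = suc r} zero (false ∷ U) eq = trans
  (∑-allSubsets (λ E → b2n ((∣ E ∣ ≡ᵇ suc r) ∧ ((false ∷ U) ⊆ᵇ E))))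
  (cong₂ _+_ (#supersets-zero U (≤-reflexive (trans (sym eq) (+-identityʳ _)))) (#supersets≡ zero U eq))
#supersets≡ {r = zero} (suc k) (false ∷ U) eq =
  contradiction (trans (sym (+-suc ∣ U ∣ k)) eq) λ ()
#supersets≡ {r = suc r} (suc k) (false ∷ U) eq = trans
  (∑-allSubsets (λ E → b2n ((∣ E ∣ ≡ᵇ suc r) ∧ ((false ∷ U) ⊆ᵇ E))))
  (trans (cong₂ _+_ (#supersets≡ k U (suc-injective (trans (sym (+-suc ∣ U ∣ k)) eq)))
                    (#supersets≡ (suc k) U eq))
         (nCk+nC[k+1]≡[n+1]C[k+1] ∣ ∁ U ∣ k))

codeg≤C : ∀ {r} (H : Family n) U k → ∣ U ∣ + k ≡ r → codeg r H U ≤ (n ∸ ∣ U ∣) C k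
codeg≤C {r = r} H U k eq = ≤-trans (codeg≤#supersets r H U)
  (≤-reflexive (trans (#supersets≡ k U eq) (cong (_C k) (∣∁p∣≡n∸∣p∣ U))))

-- Union bound: an edge above `U` meets `T` in some `w`, hence is counted by the codegree of `U`
-- with `w` added.
codeg-cover : ∀ {r M} (H : Family n) U T →
  (∀ E → H E ≡ true → Nonempty (E ∩ T)) →
  (∀ w → w ∈ T → codeg r H (U [ w ]≔ true) ≤ M) →
  codeg r H U ≤ ∣ T ∣ * M
codeg-cover {n} {r} {M} H U T cover codeg≤M = begin
  codeg r H U
    ≤⟨ ∑-mono (rSubsets n r) pointwise ⟩
  ∑ (rSubsets n r) (λ E → weight (λ w → b2n (H E ∧ ((U [ w ]≔ true) ⊆ᵇ E))) T)
    ≡⟨ weight-∑ (rSubsets n r) (λ w E → b2n (H E ∧ ((U [ w ]≔ true) ⊆ᵇ E))) T ⟨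
  weight (λ w → codeg r H (U [ w ]≔ true)) T
    ≤⟨ weight-≤ M T codeg≤M ⟩
  ∣ T ∣ * M ∎
  where
  open ≤-Reasoning
  pointwise : ∀ E → b2n (H E ∧ (U ⊆ᵇ E)) ≤ weight (λ w → b2n (H E ∧ ((U [ w ]≔ true) ⊆ᵇ E))) T
  pointwise E with H E in HE
  ... | false = z≤n
  ... | true with U ⊆ᵇ E in U⊆E
  ... | false = z≤n
  ... | true  =
    let w , w∈E∩T = cover E HE
        w∈E , w∈T = x∈p∩q⁻ E T w∈E∩T
    in ≤-trans (≤-reflexive (cong b2n (sym (insert-⊆ᵇ U U⊆E w∈E))))
               (term≤weight (λ w → b2n ((U [ w ]≔ true) ⊆ᵇ E)) w∈T)

deg≤codeg : ∀ r (H : Family n) v → deg r H v ≤ codeg r H (⊥ [ v ]≔ true)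
deg≤codeg {n} r H v = ∑-mono (rSubsets n r) λ E → b2n-mono λ e →
  cong₂ _∧_ (∧-conicalˡ (H E) (lookup E v) e)
    (insert-⊆ᵇ ⊥ (⊥-⊆ᵇ E) (lookup⇒[]= v E (∧-conicalʳ (H E) (lookup E v) e)))

#edges : ℕ → Family n → ℕ
#edges r H = codeg r H ⊥

∣insert-⊥∣ : (v : Fin n) → ∣ ⊥ [ v ]≔ true ∣ ≡ 1
∣insert-⊥∣ {n} v = trans (∣insert∣ {n} {⊥} ∉⊥) (cong suc (∣⊥∣≡0 n))

-- Double counting of pairs of an edge and a vertex of it outside `F`: each edge has `suc q`
-- vertices, at least one of them in `F`.
degSet-∁-edge : ∀ {q} (H : Family n) F → Uniform (suc q) H →
  (∀ E → H E ≡ true → Nonempty (E ∩ F)) →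
  degSet (suc q) H (∁ F) ≤ q * #edges (suc q) H
degSet-∁-edge {n} {q} H F uniform meets = begin
  degSet (suc q) H (∁ F)
    ≡⟨ weight-∑ (rSubsets n (suc q)) (λ v E → b2n (H E ∧ lookup E v)) (∁ F) ⟩
  ∑ (rSubsets n (suc q)) (λ E → weight (λ v → b2n (H E ∧ lookup E v)) (∁ F))
    ≤⟨ ∑-mono (rSubsets n (suc q)) pointwise ⟩
  ∑ (rSubsets n (suc q)) (λ E → q * b2n (H E ∧ (⊥ ⊆ᵇ E)))
    ≡⟨ ∑-*ˡ (rSubsets n (suc q)) q _ ⟩
  q * #edges (suc q) H ∎
  where
  open ≤-Reasoning
  pointwise : ∀ E → weight (λ v → b2n (H E ∧ lookup E v)) (∁ F) ≤ q * b2n (H E ∧ (⊥ ⊆ᵇ E))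
  pointwise E with H E in HE
  ... | false = ≤-trans (weight-≤ 0 (∁ F) λ _ _ → z≤n)
                  (≤-trans (≤-reflexive (*-zeroʳ ∣ ∁ F ∣)) z≤n)
  ... | true  = begin
    weight (b2n ∘ lookup E) (∁ F)  ≡⟨ weight-indicator (∁ F) E ⟩
    ∣ ∁ F ∩ E ∣                    ≤⟨ s≤s⁻¹ (subst (∣ ∁ F ∩ E ∣ <_) (uniform E HE) (p⊂q⇒∣p∣<∣q∣ proper)) ⟩
    q                              ≡⟨ *-identityʳ q ⟨
    q * 1                          ≡⟨ cong (λ b → q * b2n b) (⊥-⊆ᵇ E) ⟨
    q * b2n (⊥ ⊆ᵇ E)               ∎
    where
    proper : ∁ F ∩ E ⊂ E
    proper with meets E HE
    ... | v , v∈E∩F = let v∈E , v∈F = x∈p∩q⁻ E F v∈E∩F in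
      p∩q⊆q (∁ F) E , v , v∈E , λ v∈ → x∈p⇒x∉∁p v∈F (proj₁ (x∈p∩q⁻ (∁ F) E v∈))

-- Transversals

-- The transversals of `H`. An edge of one of two cross-intersecting families is a cover of the
-- other.
Cover : Family n → Subset n → Set
Cover H T = ∀ E → H E ≡ true → Nonempty (E ∩ T)

-- Failure comes with an explicit missing edge, which drives the branching and the case of two
-- one-vertex covers.
cover⊎miss : ∀ (H : Family n) T → Cover H T ⊎ ∃ λ E → H E ≡ true × Empty (E ∩ T)
cover⊎miss H T with anySubset? (λ E → (H E ≟ true) ×-dec ¬? (nonempty? (E ∩ T)))
... | yes miss = inj₂ miss
... | no ¬miss = inj₁ λ E HE → decidable-stable (nonempty? (E ∩ T)) λ empty → ¬miss (E , HE , empty)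

cover? : ∀ (H : Family n) T → Dec (Cover H T)
cover? H T with cover⊎miss H T
... | inj₁ cover            = yes cover
... | inj₂ (E , HE , empty) = no λ cover → empty (cover E HE)

MinimumCover : Family n → Subset n → Set
MinimumCover H T = Cover H T × (∀ T' → Cover H T' → ∣ T ∣ ≤ ∣ T' ∣)

-- `k` is the recursion measure: it bounds the size of the current cover, and each strictly smaller
-- cover lowers it.
minimumCover : ∀ (H : Family n) k {T} → ∣ T ∣ ≤ k → Cover H T → ∃ (MinimumCover H)
minimumCover H k {T} ∣T∣≤k cover
  with anySubset? (λ T' → cover? H T' ×-dec (∣ T' ∣ <? ∣ T ∣))
... | no ¬smaller = T , cover , λ T' cover' → ≮⇒≥ λ T'<T → ¬smaller (T' , cover' , T'<T)
minimumCover H zero    ∣T∣≤k cover | yes (T' , cover' , T'<T) =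
  contradiction (≤-trans T'<T ∣T∣≤k) λ ()
minimumCover H (suc k) ∣T∣≤k cover | yes (T' , cover' , T'<T) =
  minimumCover H k (s≤s⁻¹ (≤-trans T'<T ∣T∣≤k)) cover'

avoid : ∀ {E U : Subset n} {v} → Empty (E ∩ U) → v ∈ E → v ∉ U
avoid empty v∈E v∈U = empty (_ , x∈p∩q⁺ (v∈E , v∈U))

-- If no t-1 vertices cover G, then every set U of fewer than t vertices is missed by some edge of G,
-- and each edge of H above U contains one of the r vertices of that edge.
codeg-branch : ∀ {r} (H G : Family n) → Uniform r G → CrossIntersecting H G →
  ∀ {t} → (∀ T → Cover G T → t ≤ ∣ T ∣) → t ≤ r →
  ∀ k U → ∣ U ∣ + k ≡ t → codeg r H U ≤ r ^ k * ((n ∸ t) C (r ∸ t))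
codeg-branch {n} {r} H G uniform cross {t} large t≤r zero U eq =
  subst (codeg r H U ≤_) (trans (cong (λ u → (n ∸ u) C (r ∸ t)) ∣U∣) (sym (+-identityʳ _)))
    (codeg≤C H U (r ∸ t) (trans (cong (_+ (r ∸ t)) ∣U∣) (m+[n∸m]≡n t≤r)))
  where
  ∣U∣ : ∣ U ∣ ≡ t
  ∣U∣ = trans (sym (+-identityʳ _)) eq
codeg-branch {n} {r} H G uniform cross {t} large t≤r (suc k) U eq with cover⊎miss G U
... | inj₁ cover = contradiction (large U cover)
  (<⇒≱ (≤-trans (m<m+n ∣ U ∣ (s≤s z≤n)) (≤-reflexive eq)))
... | inj₂ (F , GF , empty) = subst (codeg r H U ≤_)
  (trans (cong (_* (r ^ k * ((n ∸ t) C (r ∸ t)))) (uniform F GF)) (sym (*-assoc r (r ^ k) _)))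
  (codeg-cover H U F (λ E HE → cross E F HE GF) λ w w∈F →
    codeg-branch H G uniform cross large t≤r k (U [ w ]≔ true)
      (trans (cong (_+ k) (∣insert∣ {U = U} (avoid {U = U} empty w∈F))) (trans (sym (+-suc ∣ U ∣ k)) eq)))

-- Binomial coefficients

-- The absorption identity, by induction through Pascal's rule; it stands in for quotients of
-- binomial coefficients.
[k+1]*[n+1]C[k+1]≡[n+1]*nCk : ∀ n k → suc k * (suc n C suc k) ≡ suc n * (n C k)
[k+1]*[n+1]C[k+1]≡[n+1]*nCk zero zero = refl
[k+1]*[n+1]C[k+1]≡[n+1]*nCk zero (suc k) = *-zeroʳ (suc (suc k))
[k+1]*[n+1]C[k+1]≡[n+1]*nCk (suc n) zero = trans (+-identityʳ _) (trans (nC1≡n (suc (suc n))) (sym (*-identityʳ _)))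
[k+1]*[n+1]C[k+1]≡[n+1]*nCk (suc n) (suc k) = begin
  suc (suc k) * (suc (suc n) C suc (suc k))
    ≡⟨ cong (suc (suc k) *_) (nCk+nC[k+1]≡[n+1]C[k+1] (suc n) (suc k)) ⟨
  suc (suc k) * (a + suc n C suc (suc k))
    ≡⟨ split (suc k) a _ ⟩
  a + suc k * a + suc (suc k) * (suc n C suc (suc k))
    ≡⟨ cong₂ (λ x y → a + x + y) ([k+1]*[n+1]C[k+1]≡[n+1]*nCk n k) ([k+1]*[n+1]C[k+1]≡[n+1]*nCk n (suc k)) ⟩
  a + suc n * (n C k) + suc n * (n C suc k)
    ≡⟨ merge (suc n) a (n C k) (n C suc k) ⟩
  a + suc n * (n C k + n C suc k)
    ≡⟨ cong (λ x → a + suc n * x) (nCk+nC[k+1]≡[n+1]C[k+1] n k) ⟩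
  suc (suc n) * a ∎
  where
  open ≡-Reasoning
  a = suc n C suc k
  split : ∀ k a b → suc k * (a + b) ≡ a + k * a + suc k * b
  split = solve-∀
  merge : ∀ m a x y → a + m * x + m * y ≡ a + m * (x + y)
  merge = solve-∀

-- By absorption the two coefficients have ratio `suc m` to `suc j`, which the hypothesis makes at
-- least `c`.
C-decay-step : ∀ c m j → c * suc j ≤ suc m → c * (m C j) ≤ suc m C suc j
C-decay-step c m j c*j≤m = *-cancelˡ-≤ (suc j) (begin
  suc j * (c * (m C j))    ≡⟨ lemma (suc j) c (m C j) ⟩
  c * suc j * (m C j)      ≤⟨ *-monoˡ-≤ (m C j) c*j≤m ⟩
  suc m * (m C j)          ≡⟨ [k+1]*[n+1]C[k+1]≡[n+1]*nCk m j ⟨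
  suc j * (suc m C suc j)  ∎)
  where
  open ≤-Reasoning
  lemma : ∀ a b c → a * (b * c) ≡ b * a * c
  lemma = solve-∀

-- Each of the `i` steps raises both indices by one and gains a factor `4 * r`, which pays for one
-- factor 4 and one branching factor `r`.
C-decay : ∀ {r} i j m → suc (i + j) ≡ r → 4 * (r * r) ≤ suc (i + m) →
  4 ^ i * (r ^ i * (m C j)) ≤ (i + m) C (i + j)
C-decay zero j m refl _ = ≤-reflexive (trans (+-identityʳ _) (+-identityʳ _))
C-decay {r} (suc i) j m refl 4r²≤n = begin
  4 ^ suc i * (r ^ suc i * (m C j))       ≡⟨ regroup (4 ^ i) r (r ^ i) (m C j) ⟩
  4 ^ i * (r ^ i * (4 * r * (m C j)))     ≤⟨ *-monoʳ-≤ (4 ^ i) (*-monoʳ-≤ (r ^ i) (C-decay-step (4 * r) m j step)) ⟩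
  4 ^ i * (r ^ i * (suc m C suc j))
    ≤⟨ C-decay i (suc j) (suc m) (cong suc (+-suc i j)) (≤-trans 4r²≤n (≤-reflexive (cong suc (sym (+-suc i m))))) ⟩
  (i + suc m) C (i + suc j)               ≡⟨ cong₂ _C_ (+-suc i m) (+-suc i j) ⟩
  suc (i + m) C suc (i + j)               ∎
  where
  open ≤-Reasoning
  regroup : ∀ x r y c → 4 * x * (r * y * c) ≡ x * (y * (4 * r * c))
  regroup = solve-∀
  expand : ∀ i j → (4 * suc (suc (i + j))) * suc j + 4 * suc (suc (i + j)) * suc i
             ≡ 4 * (suc (suc (i + j)) * suc (suc (i + j)))
  expand = solve-∀
  -- Here `suc i + suc j = r`, so `4 * r * suc j` is below `4 * (r * r)` by `4 * r * suc i`. This is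
  -- at least `suc i`, the gap between `suc m` and the ground set size.
  step : 4 * r * suc j ≤ suc m
  step = +-cancelʳ-≤ (suc i) _ _ (begin
    4 * r * suc j + suc i          ≤⟨ +-monoʳ-≤ (4 * r * suc j) (m≤n*m (suc i) (4 * r)) ⟩
    4 * r * suc j + 4 * r * suc i  ≡⟨ expand i j ⟩
    4 * (r * r)                    ≤⟨ 4r²≤n ⟩
    suc (suc i + m)                ≡⟨ cong suc (+-comm (suc i) m) ⟩
    suc m + suc i                  ∎)

-- Sizes of cross-intersecting families

r≤4r² : ∀ r → r ≤ 4 * (r * r)
r≤4r² zero      = z≤n
r≤4r² r@(suc _) = ≤-trans (m≤m*n r r) (m≤n*m (r * r) 4)

-- The first vertex is chosen in `T`, at a cost of `∣ T ∣`; the next `t` are chosen in edges of `G`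
-- missing the set so far, at a cost of `r` each. `C-decay` turns the resulting coefficient into
-- `(n ∸ 1) C q` with `4 ^ t` to spare.
#edges-bound : ∀ {q t} (H G : Family n) → Uniform (suc q) G → CrossIntersecting H G →
  4 * (suc q * suc q) ≤ n → (∀ T → Cover G T → suc t ≤ ∣ T ∣) → t ≤ q →
  ∀ T → Cover H T → 4 ^ t * #edges (suc q) H ≤ ∣ T ∣ * ((n ∸ 1) C q)
#edges-bound {n} {q} {t} H G uniform cross 4r²≤n large t≤q T cover = begin
  4 ^ t * #edges r H                       ≤⟨ *-monoʳ-≤ (4 ^ t) (codeg-cover H ⊥ T cover λ w _ →
                                                codeg-branch H G uniform cross large (s≤s t≤q) t (⊥ [ w ]≔ true)
                                                  (cong (_+ t) (∣insert-⊥∣ w))) ⟩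
  4 ^ t * (∣ T ∣ * (r ^ t * ((n ∸ suc t) C (q ∸ t))))
                                           ≡⟨ *-swap (4 ^ t) ∣ T ∣ _ ⟩
  ∣ T ∣ * (4 ^ t * (r ^ t * ((n ∸ suc t) C (q ∸ t))))
                                           ≤⟨ *-monoʳ-≤ ∣ T ∣ (C-decay t (q ∸ t) (n ∸ suc t) (cong suc q≡) (≤-trans 4r²≤n (≤-reflexive (sym n≡)))) ⟩
  ∣ T ∣ * ((t + (n ∸ suc t)) C (t + (q ∸ t)))
                                           ≡⟨ cong (∣ T ∣ *_) (cong₂ _C_ (cong pred n≡) q≡) ⟩
  ∣ T ∣ * ((n ∸ 1) C q)                    ∎
  where
  open ≤-Reasoning
  r = suc q
  q≡ : t + (q ∸ t) ≡ q
  q≡ = m+[n∸m]≡n t≤q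
  n≡ : suc t + (n ∸ suc t) ≡ n
  n≡ = m+[n∸m]≡n (≤-trans (s≤s t≤q) (≤-trans (r≤4r² r) 4r²≤n))

∈⇒∣∣>0 : ∀ {U : Subset n} {v} → v ∈ U → 1 ≤ ∣ U ∣
∈⇒∣∣>0 v∈U = subst (1 ≤_) (∣remove∣ v∈U) (s≤s z≤n)

cross-sym : ∀ (A B : Family n) → CrossIntersecting A B → CrossIntersecting B A
cross-sym A B cross T S BT AS with cross S T AS BT
... | v , v∈S∩T = let v∈S , v∈T = x∈p∩q⁻ S T v∈S∩T in v , x∈p∩q⁺ (v∈T , v∈S)

cover⇒∉ : ∀ {H : Family n} {T} → Cover H T → ∀ S → S ⊆ ∁ T → H S ≡ false
cover⇒∉ {H = H} {T} cover S S⊆∁T with H S in HS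
... | false = refl
... | true  = let v , v∈S∩T = cover S HS
                  v∈S , v∈T = x∈p∩q⁻ S T v∈S∩T
              in contradiction v∈T (x∈∁p⇒x∉p (S⊆∁T v∈S))

σ-by-size : ∀ {q} (A B : Family n) → Uniform (suc q) A → Uniform (suc q) B →
  CrossIntersecting A B → 4 * (suc q * suc q) ≤ n → ∀ {F} → B F ≡ true →
  (n ∸ suc q) * σ (suc q) A ≤ suc q * (q * #edges (suc q) A)
σ-by-size {n} {q} A B uniA uniB cross 4r²≤n {F} BF = begin
  (n ∸ r) * σ r A          ≡⟨ cong (_* σ r A) ∣∁F∣ ⟨
  ∣ ∁ F ∣ * σ r A          ≤⟨ σ≤average (s≤s z≤n) A (∁ F) r≤∣∁F∣ (λ S S⊆∁F _ → cover⇒∉ F-covers S S⊆∁F) ⟩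
  r * degSet r A (∁ F)     ≤⟨ *-monoʳ-≤ r (degSet-∁-edge A F uniA F-covers) ⟩
  r * (q * #edges r A)     ∎
  where
  open ≤-Reasoning
  r = suc q
  F-covers : Cover A F
  F-covers E AE = cross E F AE BF
  ∣∁F∣ : ∣ ∁ F ∣ ≡ n ∸ r
  ∣∁F∣ = trans (∣∁p∣≡n∸∣p∣ F) (cong (n ∸_) (uniB F BF))
  2r≤n : r + r ≤ n
  2r≤n = begin
    r + r        ≤⟨ +-mono-≤ (m≤m*n r r) (≤-trans (m≤m*n r r) (m≤n*m (r * r) 3)) ⟩
    4 * (r * r)  ≤⟨ 4r²≤n ⟩
    n            ∎
  r≤∣∁F∣ : r ≤ ∣ ∁ F ∣
  r≤∣∁F∣ = subst (r ≤_) (sym ∣∁F∣) (m+n≤o⇒m≤o∸n r 2r≤n)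

-- The product of the two sizes

suc≤4^ : ∀ s → suc s ≤ 4 ^ s
suc≤4^ zero    = ≤-refl
suc≤4^ (suc s) = begin
  suc (suc s)  ≤⟨ s≤s (m≤m+n (suc s) _) ⟩
  1 + (suc s + 2 * s)  ≤⟨ m≤m+n _ (2 + s) ⟩
  1 + (suc s + 2 * s) + (2 + s) ≡⟨ lemma s ⟩
  4 * suc s    ≤⟨ *-monoʳ-≤ 4 (suc≤4^ s) ⟩
  4 ^ suc s    ∎
  where
  open ≤-Reasoning
  lemma : ∀ s → 1 + (suc s + 2 * s) + (2 + s) ≡ 4 * suc s
  lemma = solve-∀

-- The exponent has to be positive, since the factor 2 fails at `4 ^ 0`; this is why one of the
-- cover sizes must exceed 1.
2*suc≤4^ : ∀ t → 2 * suc (suc t) ≤ 4 ^ suc t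
2*suc≤4^ t = begin
  2 * suc (suc t)      ≤⟨ *-monoʳ-≤ 2 (s≤s (m≤n+m (suc t) t)) ⟩
  2 * suc (t + suc t)  ≡⟨ lemma t ⟩
  4 * suc t            ≤⟨ *-monoʳ-≤ 4 (suc≤4^ t) ⟩
  4 ^ suc t            ∎
  where
  open ≤-Reasoning
  lemma : ∀ t → 2 * suc (t + suc t) ≡ 4 * suc t
  lemma = solve-∀

-- `suc s` and `suc (suc t)` stand for the two minimum cover sizes. After multiplication the powers
-- of 4 dominate both, and the size that is at least 2 leaves the factor 2.
product-arith : ∀ s t {a b c} → 4 ^ suc t * a ≤ suc s * c → 4 ^ s * b ≤ suc (suc t) * c →
  2 * (a * b) ≤ c * c
product-arith s t {a} {b} {c} a≤ b≤ = *-cancelˡ-≤ (4 ^ suc t * 4 ^ s) {{m*n≢0 _ _ {{m^n≢0 4 (suc t)}} {{m^n≢0 4 s}}}} (begin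
  4 ^ suc t * 4 ^ s * (2 * (a * b))      ≡⟨ regroup (4 ^ suc t) (4 ^ s) a b ⟩
  2 * ((4 ^ suc t * a) * (4 ^ s * b))    ≤⟨ *-monoʳ-≤ 2 (*-mono-≤ a≤ b≤) ⟩
  2 * ((suc s * c) * (suc (suc t) * c))  ≡⟨ regroup′ (suc s) (suc (suc t)) c ⟩
  2 * suc (suc t) * suc s * (c * c)      ≤⟨ *-monoˡ-≤ (c * c) (*-mono-≤ (2*suc≤4^ t) (suc≤4^ s)) ⟩
  4 ^ suc t * 4 ^ s * (c * c)            ∎)
  where
  open ≤-Reasoning
  regroup : ∀ x y a b → x * y * (2 * (a * b)) ≡ 2 * ((x * a) * (y * b))
  regroup = solve-∀
  regroup′ : ∀ s t c → 2 * ((s * c) * (t * c)) ≡ 2 * t * s * (c * c)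
  regroup′ = solve-∀

∉insert-⊥ : ∀ {v w : Fin n} → v ≢ w → w ∉ ⊥ [ v ]≔ true
∉insert-⊥ {n} {v} {w} v≢w w∈ =
  contradiction (trans (sym ([]=⇒lookup w∈)) (trans (lookup∘update′ (v≢w ∘ sym) (⊥ {n}) true) (lookup-replicate w false))) λ ()

-- With ground set `2 + m` and uniformity `2 + k`, the coefficient in the theorem is `m C k`, free
-- of truncated subtraction.
codeg-pair : ∀ {m k} (H : Family (2 + m)) v w → v ≢ w →
  codeg (2 + k) H ((⊥ [ v ]≔ true) [ w ]≔ true) ≤ m C k
codeg-pair {m} {k} H v w v≢w = subst (λ u → codeg (2 + k) H vw ≤ ((2 + m) ∸ u) C k) ∣vw∣
  (codeg≤C H vw k (cong (_+ k) ∣vw∣))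
  where
  vw = (⊥ [ v ]≔ true) [ w ]≔ true
  ∣vw∣ : ∣ vw ∣ ≡ 2
  ∣vw∣ = trans (∣insert∣ {U = ⊥ [ v ]≔ true} (∉insert-⊥ v≢w)) (cong suc (∣insert-⊥∣ v))

-- Every edge contains the vertex of `T` and, by disjointness, a different vertex of `F`. The `r`
-- possible pairs have codegree at most `m C k` each.
#edges-small : ∀ {k m} (H : Family (2 + m)) → let r = 2 + k in 4 * (r * r) ≤ 2 + m →
  ∀ T → ∣ T ∣ ≡ 1 → Cover H T → ∀ F → ∣ F ∣ ≡ r → Cover H F → Empty (F ∩ T) →
  4 * #edges r H ≤ suc m C suc k
#edges-small {k} {m} H 4r²≤n T ∣T∣ coverT F ∣F∣ coverF disjoint = begin
  4 * #edges r H               ≤⟨ *-monoʳ-≤ 4 (codeg-cover H ⊥ T coverT λ w w∈T →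
                                    codeg-cover H (⊥ [ w ]≔ true) F coverF λ v v∈F → codeg-pair H w v
                                      (λ { refl → disjoint (w , x∈p∩q⁺ (v∈F , w∈T)) })) ⟩
  4 * (∣ T ∣ * (∣ F ∣ * (m C k)))
                               ≡⟨ cong₂ (λ x y → 4 * (x * (y * (m C k)))) ∣T∣ ∣F∣ ⟩
  4 * (1 * (r * (m C k)))      ≡⟨ lemma r (m C k) ⟩
  4 * r * (m C k)              ≤⟨ C-decay-step (4 * r) m k (s≤s⁻¹ step) ⟩
  suc m C suc k                ∎
  where
  open ≤-Reasoning
  r = 2 + k
  lemma : ∀ r c → 4 * (1 * (r * c)) ≡ 4 * r * c
  lemma = solve-∀
  expand : ∀ k → 4 * (2 + k) * suc k + 4 * (2 + k) ≡ 4 * ((2 + k) * (2 + k))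
  expand = solve-∀
  -- The slack `4 * r` in the hypothesis pays for passing from `2 + m` to `suc m`.
  step : suc (4 * r * suc k) ≤ 2 + m
  step = begin
    1 + 4 * r * suc k        ≡⟨ +-comm 1 _ ⟩
    4 * r * suc k + 1        ≤⟨ +-monoʳ-≤ (4 * r * suc k) (s≤s z≤n) ⟩
    4 * r * suc k + 4 * r    ≡⟨ expand k ⟩
    4 * (r * r)              ≤⟨ 4r²≤n ⟩
    2 + m                    ∎

module _ {k m : ℕ} (A B : Family (2 + m))
  (uniA : Uniform (2 + k) A) (uniB : Uniform (2 + k) B) (cross : CrossIntersecting A B)
  (4r²≤n : 4 * ((2 + k) * (2 + k)) ≤ 2 + m) where

  private
    r = 2 + k
    a = #edges r A
    b = #edges r B
    c = suc m C suc k

  -- The vertex is encoded as a one-element cover, the form in which minimum covers provide it.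
  CommonVertex : Set
  CommonVertex = ∃ λ T → ∣ T ∣ ≡ 1 × Cover A T × Cover B T

  #edges-product : ∀ {E F} → A E ≡ true → B F ≡ true → CommonVertex ⊎ 2 * (a * b) ≤ c * c
  #edges-product {E} {F} AE BF
    with minimumCover A ∣ F ∣ ≤-refl (λ E′ AE′ → cross E′ F AE′ BF)
       | minimumCover B ∣ E ∣ ≤-refl (λ F′ BF′ → cross-sym A B cross F′ E BF′ AE)
  ... | S , coverA , minA | T , coverB , minB =
    split _ _ refl refl
    where
    split : ∀ s t → s ≡ ∣ S ∣ → t ≡ ∣ T ∣ → CommonVertex ⊎ 2 * (a * b) ≤ c * c
    split zero t ∣S∣ ∣T∣ = let v , v∈ = coverA E AE in
      contradiction (≤-trans (∈⇒∣∣>0 (proj₂ (x∈p∩q⁻ E S v∈))) (≤-reflexive (sym ∣S∣))) λ ()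
    split (suc s) zero ∣S∣ ∣T∣ = let v , v∈ = coverB F BF in
      contradiction (≤-trans (∈⇒∣∣>0 (proj₂ (x∈p∩q⁻ F T v∈))) (≤-reflexive (sym ∣T∣))) λ ()
    split (suc s) (suc t) ∣S∣ ∣T∣ = finish s t ∣S∣ ∣T∣ a≤ b≤
      where
      -- `F` covers `A` with `r` vertices, so minimality bounds the cover size; `s` is that size
      -- less one.
      s≤ : s ≤ suc k
      s≤ = s≤s⁻¹ (≤-trans (≤-reflexive ∣S∣) (≤-trans (minA F λ E′ AE′ → cross E′ F AE′ BF) (≤-reflexive (uniB F BF))))
      t≤ : t ≤ suc k
      t≤ = s≤s⁻¹ (≤-trans (≤-reflexive ∣T∣)
             (≤-trans (minB E λ F′ BF′ → cross-sym A B cross F′ E BF′ AE) (≤-reflexive (uniA E AE))))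
      a≤ : 4 ^ t * a ≤ suc s * c
      a≤ = subst (λ x → 4 ^ t * a ≤ x * c) (sym ∣S∣)
        (#edges-bound A B uniB cross 4r²≤n (λ T′ → subst (_≤ ∣ T′ ∣) (sym ∣T∣) ∘ minB T′) t≤ S coverA)
      b≤ : 4 ^ s * b ≤ suc t * c
      b≤ = subst (λ x → 4 ^ s * b ≤ x * c) (sym ∣T∣)
        (#edges-bound B A uniA (cross-sym A B cross) 4r²≤n
          (λ S′ → subst (_≤ ∣ S′ ∣) (sym ∣S∣) ∘ minA S′) s≤ T coverB)
      finish : ∀ s t → suc s ≡ ∣ S ∣ → suc t ≡ ∣ T ∣ → 4 ^ t * a ≤ suc s * c → 4 ^ s * b ≤ suc t * c →
        CommonVertex ⊎ 2 * (a * b) ≤ c * c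
      finish s (suc t) _ _ a≤ b≤ = inj₂ (product-arith s t a≤ b≤)
      -- The families swap roles, because `product-arith` expects the size above 1 in second place.
      finish (suc s) zero _ _ a≤ b≤ =
        inj₂ (subst (λ x → 2 * x ≤ c * c) (*-comm b a) (product-arith zero s b≤ a≤))
      finish zero zero ∣S∣ ∣T∣ a≤ b≤ with cover⊎miss B S
      ... | inj₁ coverB = inj₁ (S , sym ∣S∣ , coverA , coverB)
      -- `F′` and the single vertex of `S` give `4 * a ≤ c`; for `B` the bound `b ≤ c` from its
      -- one-vertex cover is enough.
      ... | inj₂ (F′ , BF′ , disjoint) = inj₂ (begin
        2 * (a * b)    ≤⟨ *-monoˡ-≤ (a * b) (s≤s {1} {3} (s≤s z≤n)) ⟩
        4 * (a * b)    ≡⟨ *-assoc 4 a b ⟨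
        4 * a * b      ≤⟨ *-mono-≤
                            (#edges-small A 4r²≤n S (sym ∣S∣) coverA F′ (uniB F′ BF′) (λ E′ AE′ → cross E′ F′ AE′ BF′) disjoint)
                            (subst₂ _≤_ (*-identityˡ b) (*-identityˡ c) b≤) ⟩
        c * c          ∎)
        where open ≤-Reasoning

-- Ore-degrees of a star and of the empty family

σ-star : ∀ {k m} (H : Family (2 + m)) → let r = 2 + k in 4 * (r * r) ≤ 2 + m →
  ∀ T → ∣ T ∣ ≡ 1 → Cover H T → σ r H ≤ r * (m C k)
σ-star {k} {m} H 4r²≤n T ∣T∣ cover = *-cancelˡ-≤ (suc m) (begin
  suc m * σ r H          ≡⟨ cong (_* σ r H) ∣∁T∣ ⟨
  ∣ ∁ T ∣ * σ r H        ≤⟨ σ≤average (s≤s z≤n) H (∁ T) (subst (r ≤_) (sym ∣∁T∣) r≤) (λ S S⊆∁T _ → cover⇒∉ cover S S⊆∁T) ⟩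
  r * degSet r H (∁ T)   ≤⟨ *-monoʳ-≤ r (weight-≤ (m C k) (∁ T) deg≤) ⟩
  r * (∣ ∁ T ∣ * (m C k))  ≡⟨ cong (λ x → r * (x * (m C k))) ∣∁T∣ ⟩
  r * (suc m * (m C k))  ≡⟨ *-swap r (suc m) (m C k) ⟩
  suc m * (r * (m C k))  ∎)
  where
  open ≤-Reasoning
  r = 2 + k
  ∣∁T∣ : ∣ ∁ T ∣ ≡ suc m
  ∣∁T∣ = trans (∣∁p∣≡n∸∣p∣ T) (cong ((2 + m) ∸_) ∣T∣)
  r≤ : r ≤ suc m
  r≤ = s≤s⁻¹ (begin
    suc r        ≡⟨ +-comm 1 r ⟩
    r + 1        ≤⟨ +-mono-≤ (m≤m*n r r) (s≤s z≤n) ⟩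
    r * r + (r * r + (r * r + (r * r + 0)))  ≤⟨ 4r²≤n ⟩
    2 + m        ∎)
  -- An edge through `v` also contains the vertex of `T`, which differs from `v`, so a pair codegree
  -- bounds the degree.
  deg≤ : ∀ v → v ∈ ∁ T → deg r H v ≤ m C k
  deg≤ v v∈∁T = begin
    deg r H v                  ≤⟨ deg≤codeg r H v ⟩
    codeg r H (⊥ [ v ]≔ true)  ≤⟨ codeg-cover H (⊥ [ v ]≔ true) T cover (λ w w∈T → codeg-pair H v w (λ { refl → x∈∁p⇒x∉p v∈∁T w∈T })) ⟩
    ∣ T ∣ * (m C k)            ≡⟨ cong (_* (m C k)) ∣T∣ ⟩
    1 * (m C k)                ≡⟨ *-identityˡ _ ⟩
    m C k                      ∎

-- All degrees vanish, and averaging over `⊤` gives the claim without exhibiting an `r`-subset.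
σ-empty : ∀ {r} → 1 ≤ r → r ≤ n → (H : Family n) → (∀ E → H E ≡ false) → σ r H ≡ 0
σ-empty {n} {r} 1≤r r≤n H H≡∅ = n≤0⇒n≡0 (*-cancelˡ-≤ ∣ ⊤ {n} ∣ (begin
  ∣ ⊤ {n} ∣ * σ r H     ≤⟨ σ≤average 1≤r H ⊤ (≤-trans r≤n (≤-reflexive (sym (∣⊤∣≡n n)))) (λ S _ _ → H≡∅ S) ⟩
  r * degSet r H ⊤      ≤⟨ *-monoʳ-≤ r (weight-≤ 0 ⊤ λ v _ → ≤-reflexive (deg≡0 v)) ⟩
  r * (∣ ⊤ {n} ∣ * 0)   ≡⟨ lemma r ∣ ⊤ {n} ∣ ⟩
  ∣ ⊤ {n} ∣ * 0         ∎))
  where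
  open ≤-Reasoning
  lemma : ∀ r c → r * (c * 0) ≡ c * 0
  lemma = solve-∀
  instance
    ∣⊤∣≢0 : NonZero ∣ ⊤ {n} ∣
    ∣⊤∣≢0 = >-nonZero (subst (0 <_) (sym (∣⊤∣≡n n)) (≤-trans 1≤r r≤n))
  deg≡0 : ∀ v → deg r H v ≡ 0
  deg≡0 v = ∑-zero (rSubsets n r) λ E → cong (λ h → b2n (h ∧ lookup E v)) (H≡∅ E)

empty⊎edge : ∀ (H : Family n) → (∀ E → H E ≡ false) ⊎ ∃ λ E → H E ≡ true
empty⊎edge H with anySubset? (λ E → H E ≟ true)
... | yes edge = inj₂ edge
... | no ¬edge = inj₁ λ E → ¬-not (λ HE → ¬edge (E , HE))

-- Used with D = n − r and q = r − 1, so that D + q = n − 1.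
square-bound : ∀ {D q} → 3 * q ≤ D → (D + q) * (D + q) ≤ 2 * (D * D)
square-bound {D} {q} 3q≤D = begin
  (D + q) * (D + q)              ≡⟨ expand D q ⟩
  D * D + (2 * q * D + q * q)    ≤⟨ +-monoʳ-≤ (D * D) (+-monoʳ-≤ (2 * q * D) (*-monoʳ-≤ q (≤-trans (m≤n*m q 3) 3q≤D))) ⟩
  D * D + (2 * q * D + q * D)    ≡⟨ collect D q ⟩
  D * D + 3 * q * D              ≤⟨ +-monoʳ-≤ (D * D) (*-monoˡ-≤ D 3q≤D) ⟩
  D * D + D * D                  ≡⟨ double (D * D) ⟩
  2 * (D * D)                    ∎
  where
  open ≤-Reasoning
  expand : ∀ D q → (D + q) * (D + q) ≡ D * D + (2 * q * D + q * q)
  expand = solve-∀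
  collect : ∀ D q → D * D + (2 * q * D + q * D) ≡ D * D + 3 * q * D
  collect = solve-∀
  double : ∀ x → x + x ≡ 2 * x
  double = solve-∀

-- `x`, `y` are the Ore-degrees, `a`, `b` the sizes, `N` is n - 1, and `c`, `e` are C(n-1, r-1) and
-- C(n-2, r-2). The factor 2 gained in `2 * (a * b)` pays for the loss from `N` to `D`.
final-arith : ∀ {D N r q x y a b c e} .{{_ : NonZero D}} →
  D * x ≤ r * (q * a) → D * y ≤ r * (q * b) → 2 * (a * b) ≤ c * c → q * c ≡ N * e →
  N * N ≤ 2 * (D * D) → x * y ≤ (r * e) * (r * e)
final-arith {D} {N} {r} {q} {x} {y} {a} {b} {c} {e} Dx≤ Dy≤ 2ab≤c² qc≡Ne N²≤ =
  *-cancelˡ-≤ (2 * (D * D)) {{m*n≢0 2 (D * D) {{_}} {{m*n≢0 D D}}}} (begin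
    2 * (D * D) * (x * y)                ≡⟨ regroup₁ D x y ⟩
    2 * ((D * x) * (D * y))              ≤⟨ *-monoʳ-≤ 2 (*-mono-≤ Dx≤ Dy≤) ⟩
    2 * ((r * (q * a)) * (r * (q * b)))  ≡⟨ regroup₂ r q a b ⟩
    (r * q) * (r * q) * (2 * (a * b))    ≤⟨ *-monoʳ-≤ ((r * q) * (r * q)) 2ab≤c² ⟩
    (r * q) * (r * q) * (c * c)          ≡⟨ regroup₃ r q c ⟩
    r * (q * c) * (r * (q * c))          ≡⟨ cong (λ z → r * z * (r * z)) qc≡Ne ⟩
    r * (N * e) * (r * (N * e))          ≡⟨ regroup₄ r N e ⟩
    N * N * ((r * e) * (r * e))          ≤⟨ *-monoˡ-≤ ((r * e) * (r * e)) N²≤ ⟩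
    2 * (D * D) * ((r * e) * (r * e))    ∎)
  where
  open ≤-Reasoning
  regroup₁ : ∀ D x y → 2 * (D * D) * (x * y) ≡ 2 * ((D * x) * (D * y))
  regroup₁ = solve-∀
  regroup₂ : ∀ r q a b → 2 * ((r * (q * a)) * (r * (q * b))) ≡ (r * q) * (r * q) * (2 * (a * b))
  regroup₂ = solve-∀
  regroup₃ : ∀ r q c → (r * q) * (r * q) * (c * c) ≡ r * (q * c) * (r * (q * c))
  regroup₃ = solve-∀
  regroup₄ : ∀ r N e → r * (N * e) * (r * (N * e)) ≡ N * N * ((r * e) * (r * e))
  regroup₄ = solve-∀

-- The product of the Ore-degrees

σ-product : ∀ {k m} (A B : Family (2 + m)) → let r = 2 + k in
  Uniform r A → Uniform r B → CrossIntersecting A B → 4 * (r * r) ≤ 2 + m →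
  ∀ {E F} → A E ≡ true → B F ≡ true → σ r A * σ r B ≤ (r * (m C k)) * (r * (m C k))
σ-product {k} {m} A B uniA uniB cross 4r²≤n AE BF
  with #edges-product A B uniA uniB cross 4r²≤n AE BF
... | inj₁ (T , ∣T∣ , coverA , coverB) =
  *-mono-≤ (σ-star A 4r²≤n T ∣T∣ coverA) (σ-star B 4r²≤n T ∣T∣ coverB)
... | inj₂ 2ab≤c² = final-arith {m ∸ k} {suc m} {2 + k} {suc k}
    {a = #edges (2 + k) A} {#edges (2 + k) B} {suc m C suc k} {m C k} {{>-nonZero (≤-trans (s≤s z≤n) 3q≤D)}}
    (σ-by-size A B uniA uniB cross 4r²≤n BF)
    (σ-by-size B A uniB uniA (cross-sym A B cross) 4r²≤n AE)
    2ab≤c²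
    ([k+1]*[n+1]C[k+1]≡[n+1]*nCk m k)
    (subst (λ N → N * N ≤ 2 * ((m ∸ k) * (m ∸ k))) D+q≡N (square-bound 3q≤D))
  where
  open ≤-Reasoning
  -- The polynomial in `k` is the exact slack of 4r² over 3(r - 1) + r at `r = 2 + k`.
  expand : ∀ k → 3 * suc k + (2 + k) + (4 * (k * k) + 12 * k + 11) ≡ 4 * ((2 + k) * (2 + k))
  expand = solve-∀
  3q≤D : 3 * suc k ≤ m ∸ k
  3q≤D = m+n≤o⇒m≤o∸n (3 * suc k) (s≤s⁻¹ (s≤s⁻¹ (begin
    2 + (3 * suc k + k)  ≡⟨ shift k ⟩
    3 * suc k + (2 + k)  ≤⟨ m≤m+n _ (4 * (k * k) + 12 * k + 11) ⟩
    3 * suc k + (2 + k) + (4 * (k * k) + 12 * k + 11)  ≡⟨ expand k ⟩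
    4 * ((2 + k) * (2 + k))  ≤⟨ 4r²≤n ⟩
    2 + m  ∎)))
    where
    shift : ∀ k → 2 + (3 * suc k + k) ≡ 3 * suc k + (2 + k)
    shift = solve-∀
  k≤m : k ≤ m
  k≤m = s≤s⁻¹ (s≤s⁻¹ (≤-trans (r≤4r² (2 + k)) 4r²≤n))
  D+q≡N : m ∸ k + suc k ≡ suc m
  D+q≡N = trans (+-suc (m ∸ k) k) (cong suc (m∸n+n≡m
    k≤m))

r*r≡r^2 : ∀ r → r * r ≡ r ^ 2
r*r≡r^2 r = cong (r *_) (sym (*-identityʳ r))

4r*r≤n : ∀ r → 4 * r ^ 2 ≤ n → 4 * (r * r) ≤ n
4r*r≤n r = ≤-trans (≤-reflexive (cong (4 *_) (r*r≡r^2 r)))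

theorem1p10 : (r n : ℕ) → 1 ≤ r → 4 * r ^ 2 ≤ n →
    (A B : Family n) → Uniform r A → Uniform r B → CrossIntersecting A B →
    σ r A * σ r B ≤ r ^ 2 * binom-2 n r ^ 2
theorem1p10 r n 1≤r 4r²≤n A B uniA uniB cross
  with empty⊎edge A | empty⊎edge B
-- An empty family offers no edge to use as a cover, but its `σ` is already 0.
... | inj₁ A≡∅ | _ rewrite σ-empty 1≤r (≤-trans (r≤4r² r) (4r*r≤n r 4r²≤n)) A A≡∅ = z≤n
... | inj₂ _ | inj₁ B≡∅ rewrite σ-empty 1≤r (≤-trans (r≤4r² r) (4r*r≤n r 4r²≤n)) B B≡∅ | *-zeroʳ (σ r A) = z≤n
-- For `r = 1` the right side vanishes, and `σ-by-size` with `q = 0` forces `σ 1 A` to be 0.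
theorem1p10 1 n 1≤r 4r²≤n A B uniA uniB cross | inj₂ (E , AE) | inj₂ (F , BF) =
  ≤-trans (*-monoˡ-≤ (σ 1 B) σA≤0) z≤n
  where
  σA≤0 : σ 1 A ≤ 0
  σA≤0 = *-cancelˡ-≤ (n ∸ 1) {{>-nonZero (m<n⇒0<n∸m (≤-trans (s≤s (s≤s z≤n)) 4r²≤n))}}
    (≤-trans (σ-by-size A B uniA uniB cross 4r²≤n BF) (≤-reflexive (sym (*-zeroʳ (n ∸ 1)))))
theorem1p10 (suc (suc k)) 1 1≤r (s≤s ()) A B uniA uniB cross | _ | _
theorem1p10 (suc (suc k)) (suc (suc m)) 1≤r 4r²≤n A B uniA uniB cross | inj₂ (E , AE) | inj₂ (F , BF) =
  ≤-trans (σ-product A B uniA uniB cross (4r*r≤n (2 + k) 4r²≤n) AE BF)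
    (≤-reflexive (regroup (2 + k) (m C k)))
  where
  regroup : ∀ r c → (r * c) * (r * c) ≡ r ^ 2 * c ^ 2
  regroup r c = trans (*-interchange r c r c) (cong₂ _*_ (r*r≡r^2 r) (r*r≡r^2 c))
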